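{- $\mathbf{DSt}$ is a discriminator variety of level $1$; that is, $\mathbf{DSt}$ is a discriminator variety and $\mathbf{DSt}\subseteq\mathbf{DQD_1}$.
   Context: A semi-Heyting algebra is an algebra $\langle L,\vee,\wedge,\to,0,1\rangle$ such that $\langle L,\vee,\wedge,0,1\rangle$ is a bounded lattice and the identities $x\wedge(x\to y)\approx x\wedge y$, $x\wedge(y\to z)\approx x\wedge[(x\wedge y)\to(x\wedge z)]$, $x\to x\approx 1$ hold; write $x^*:=x\to 0$. A $\mathbf{DQD}$-algebra (dually quasi-De Morgan semi-Heyting algebra) is an algebra $\langle L,\vee,\wedge,\to,{}',0,1\rangle$ whose reduct $\langle L,\vee,\wedge,\to,0,1\rangle$ is a semi-Heyting algebra and which satisfies: $0'\approx 1$ and $1'\approx 0$; $(x\wedge y)'\approx x'\vee y'$; $(x\vee y)''\approx x''\vee y''$; $x''\le x$. $\mathbf{DQD}$ denotes the variety of all $\mathbf{DQD}$-algebras. $\mathbf{DSt}$ (dually Stone semi-Heyting algebras) is the subvariety of $\mathbf{DQD}$ defined by $x'\wedge x''\approx 0$. Levels: put $x^{(0)}:=x$ and $x^{(n+1)}:=((x^{(n)})')^*$; put $t_0(x):=x$ and $t_{n+1}(x):=t_n(x)\wedge x^{(n+1)}$. $\mathbf{DQD_n}$ is the subvariety of $\mathbf{DQD}$ defined by $t_n(x)\approx t_{n+1}(x)$. A discriminator variety is one generated by a class of algebras on all of which a single ternary term $t$ represents the discriminator function ($t(x,x,z)=z$ and $t(x,y,z)=x$ if $x\ne y$). -}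

module Defs where

open import Level using (Level; _⊔_; 0ℓ) renaming (suc to lsuc)
open import Algebra.Core using (Op₁; Op₂)
import Algebra.Definitions as AlgDefs
import Algebra.Lattice.Structures as LatticeStructures
open import Data.Fin.Base using (Fin)
open import Data.Nat.Base using (ℕ; zero; suc)
open import Data.Product.Base using (_×_; _,_; ∃-syntax)
open import Data.Vec.Base using (_∷_; []; lookup)
open import Relation.Binary.Core using (Rel)
open import Relation.Binary.Structures using (IsEquivalence)
open import Relation.Nullary.Negation.Core using (¬_)
open import Relation.Unary using (Pred; _⊆_; _≐_)

-- Algebras of type ⟨∨, ∧, →, ′, 0, 1⟩, with no identities imposed.  The
-- carrier is a setoid, so that quotients are available: _≈_ is the equality
-- of the algebra, and "≠" is ¬ (_ ≈ _).
record Algebra (c ℓ : Level) : Set (lsuc (c ⊔ ℓ)) where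
  infix  4 _≈_
  infixr 5 _⇒_
  infixr 6 _∨_
  infixr 7 _∧_
  infix  9 _′
  field
    Carrier : Set c
    _≈_     : Rel Carrier ℓ
    _∨_     : Op₂ Carrier
    _∧_     : Op₂ Carrier
    _⇒_     : Op₂ Carrier
    _′      : Op₁ Carrier
    𝟘       : Carrier
    𝟙       : Carrier

  open AlgDefs _≈_ using (Congruent₁; Congruent₂)

  field
    isEquivalence : IsEquivalence _≈_
    ∨-cong        : Congruent₂ _∨_
    ∧-cong        : Congruent₂ _∧_
    ⇒-cong        : Congruent₂ _⇒_
    ′-cong        : Congruent₁ _′

  infix 4 _≤_
  infix 9 _*

  _≤_ : Rel Carrier ℓ
  x ≤ y = x ∧ y ≈ x

  _* : Op₁ Carrier
  x * = x ⇒ 𝟘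

  -- x ^⟨ n ⟩ is x⁽ⁿ⁾, the n-fold iterate of x ↦ (x′)*.
  _^⟨_⟩ : Carrier → ℕ → Carrier
  x ^⟨ zero ⟩  = x
  x ^⟨ suc n ⟩ = ((x ^⟨ n ⟩) ′) *

  t[_] : ℕ → Carrier → Carrier
  t[ zero ]  x = x
  t[ suc n ] x = t[ n ] x ∧ (x ^⟨ suc n ⟩)

module _ {c ℓ : Level} (A : Algebra c ℓ) where
  open Algebra A
  open AlgDefs _≈_ using (Identity)
  open LatticeStructures _≈_ using (IsLattice)

  record IsSemiHeyting : Set (c ⊔ ℓ) where
    field
      isLattice  : IsLattice _∨_ _∧_
      ∨-identity : Identity 𝟘 _∨_
      ∧-identity : Identity 𝟙 _∧_
      x∧[x⇒y]    : ∀ x y → x ∧ (x ⇒ y) ≈ x ∧ y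
      x∧[y⇒z]    : ∀ x y z → x ∧ (y ⇒ z) ≈ x ∧ ((x ∧ y) ⇒ (x ∧ z))
      x⇒x        : ∀ x → (x ⇒ x) ≈ 𝟙

  record IsDQD : Set (c ⊔ ℓ) where
    field
      isSemiHeyting : IsSemiHeyting
      𝟘′            : 𝟘 ′ ≈ 𝟙
      𝟙′            : 𝟙 ′ ≈ 𝟘
      [x∧y]′        : ∀ x y → (x ∧ y) ′ ≈ (x ′) ∨ (y ′)
      [x∨y]′′       : ∀ x y → ((x ∨ y) ′) ′ ≈ ((x ′) ′) ∨ ((y ′) ′)
      x′′≤x         : ∀ x → (x ′) ′ ≤ x

  record IsDSt : Set (c ⊔ ℓ) where
    field
      isDQD  : IsDQD
      x′∧x′′ : ∀ x → (x ′) ∧ ((x ′) ′) ≈ 𝟘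

  record IsDQDₙ (n : ℕ) : Set (c ⊔ ℓ) where
    field
      isDQD : IsDQD
      level : ∀ x → t[ n ] x ≈ t[ suc n ] x

DSt : (c ℓ : Level) → Pred (Algebra c ℓ) (c ⊔ ℓ)
DSt c ℓ = IsDSt

DQD[_] : ℕ → (c ℓ : Level) → Pred (Algebra c ℓ) (c ⊔ ℓ)
DQD[ n ] c ℓ A = IsDQDₙ A n

data Term (X : Set) : Set where
  var           : X → Term X
  _∨ₜ_ _∧ₜ_ _⇒ₜ_ : Term X → Term X → Term X
  _′ₜ           : Term X → Term X
  𝟘ₜ 𝟙ₜ         : Term X

module _ {c ℓ : Level} (A : Algebra c ℓ) where
  open Algebra A

  ⟦_⟧ : {X : Set} → Term X → (X → Carrier) → Carrier
  ⟦ var x ⟧  ρ = ρ x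
  ⟦ s ∨ₜ t ⟧ ρ = ⟦ s ⟧ ρ ∨ ⟦ t ⟧ ρ
  ⟦ s ∧ₜ t ⟧ ρ = ⟦ s ⟧ ρ ∧ ⟦ t ⟧ ρ
  ⟦ s ⇒ₜ t ⟧ ρ = ⟦ s ⟧ ρ ⇒ ⟦ t ⟧ ρ
  ⟦ t ′ₜ ⟧   ρ = (⟦ t ⟧ ρ) ′
  ⟦ 𝟘ₜ ⟧     ρ = 𝟘
  ⟦ 𝟙ₜ ⟧     ρ = 𝟙

  RepresentsDiscriminator : Term (Fin 3) → Set (c ⊔ ℓ)
  RepresentsDiscriminator t =
    (∀ x z → eval x x z ≈ z) × (∀ x y z → ¬ (x ≈ y) → eval x y z ≈ x)
    where
    eval : Carrier → Carrier → Carrier → Carrier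
    eval x y z = ⟦ t ⟧ (lookup (x ∷ y ∷ z ∷ []))

Equation : Set
Equation = Term ℕ × Term ℕ

_⊨_ : {c ℓ : Level} → Algebra c ℓ → Equation → Set (c ⊔ ℓ)
A ⊨ (s , t) = ∀ (ρ : ℕ → Carrier) → ⟦_⟧ A s ρ ≈ ⟦_⟧ A t ρ
  where open Algebra A

module _ {c ℓ : Level} where

  Mod : Pred Equation 0ℓ → Pred (Algebra c ℓ) (c ⊔ ℓ)
  Mod Σ A = ∀ e → Σ e → A ⊨ e

  IsVariety : Pred (Algebra c ℓ) (c ⊔ ℓ) → Set (lsuc (c ⊔ ℓ))
  IsVariety V = ∃[ Σ ] V ≐ Mod Σ

  -- V is the least variety containing K.  Since Mod Σ is the intersection of
  -- the varieties defined by the single equations of Σ, the universe level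
  -- chosen for sets of equations is immaterial.
  IsGeneratedBy : Pred (Algebra c ℓ) (c ⊔ ℓ) → Pred (Algebra c ℓ) (c ⊔ ℓ) →
                  Set (lsuc (c ⊔ ℓ))
  IsGeneratedBy V K =
    IsVariety V × K ⊆ V × (∀ W → IsVariety W → K ⊆ W → V ⊆ W)

  IsDiscriminatorVariety : Pred (Algebra c ℓ) (c ⊔ ℓ) → Set (lsuc (c ⊔ ℓ))
  IsDiscriminatorVariety V =
    ∃[ K ] IsGeneratedBy V K ×
           (∃[ t ] (∀ A → K A → RepresentsDiscriminator A t))

{-# OPTIONS --safe #-}
module Submission where

-- In a dually Stone semi-Heyting algebra every x′ is complemented, with
-- complement x′′.  Hence (x′)* ≈ x′′, and since x′′′ ≈ x′ the levels are
-- constant from level 1 on: this is the inclusion in DQD₁.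
--
-- Put x ⇔ y = (x ⇒ y) ∧ (y ⇒ x).  Then c ≤ x ⇔ y iff c ∧ x ≈ c ∧ y, so that
-- x ⇔ y ≈ 𝟙 iff x ≈ y.  In an algebra where u ≉ 𝟙 implies u′ ≈ 𝟙, the term
--
--   ((x ⇔ y)′ ∧ x) ∨ ((x ⇔ y)′′ ∧ z)
--
-- therefore represents the discriminator.  Let K be the class of dually Stone
-- algebras on which it does.  It remains to show that K generates DSt: if the
-- equation s ≈ t holds throughout K, then it holds in every dually Stone A
-- under every valuation ρ.  Classically, A is a subdirect product of simple
-- algebras.  The following constructive argument replaces that.
--
-- A filter F closed under x ↦ x′′ yields a congruence, relating x and y when
-- x ⇔ y ∈ F: this says that c ∧ x ≈ c ∧ y for some central c ∈ F, and such
-- agreement on c is respected by all operations (agree-∨ to agree-′).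
-- Enumerate the terms, and let b range over their values under ρ.  Adjoin each
-- b in turn to the filter, provided that b′ is not yet in it.  The resulting
-- filter F contains b′ whenever it does not contain b (decides), and contains
-- 𝟘 only if the initial filter already did (proper).  Thus the term algebra
-- modulo F belongs to K, whether or not F is proper.  Start with the filter of
-- all elements above (s ⇔ t)′.  As s ≈ t holds modulo F, both s ⇔ t and its
-- complement (s ⇔ t)′ are in F, so 𝟘 is in F, hence in the initial filter:
-- (s ⇔ t)′ ≈ 𝟘, whence s ⇔ t ≈ 𝟙 and s ≈ t in A.

open import Defs
open import Level using (Level; _⊔_; Lift; lift; 0ℓ)
open import Algebra.Lattice.Bundles using (Lattice)
import Algebra.Lattice.Properties.Lattice as LatticeProperties
import Algebra.Lattice.Structures as LatticeStructures
open import Data.Fin.Base using (Fin; zero; suc)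
open import Data.List.Base using (List; []; _∷_; _++_; map; cartesianProductWith)
open import Data.List.Membership.Propositional using (_∈_)
open import Data.List.Membership.Propositional.Properties
  using (∈-++⁺ˡ; ∈-++⁺ʳ; ∈-map⁺; ∈-cartesianProductWith⁺)
open import Data.List.Relation.Unary.Any using (here; there)
open import Data.Nat.Base as ℕ using (ℕ; zero; suc; _≤′_; ≤′-refl; ≤′-step)
open import Data.Nat.Properties using (≤⇒≤′; m≤m⊔n; m≤n⊔m)
open import Data.Product.Base using (_×_; _,_; proj₁; proj₂; ∃-syntax)
open import Data.Sum.Base using (_⊎_; inj₁; inj₂)
open import Function.Base using (_∘_; _on_)
open import Relation.Binary.Bundles using (Poset)
open import Relation.Binary.Core using (Rel)
open import Relation.Binary.Lattice.Bundles using (HeytingAlgebra)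
import Relation.Binary.Lattice.Properties.DistributiveLattice as DistributiveProperties
import Relation.Binary.Lattice.Properties.HeytingAlgebra as HeytingProperties
import Relation.Binary.Lattice.Properties.JoinSemilattice as JoinProperties
import Relation.Binary.Lattice.Properties.MeetSemilattice as MeetProperties
import Relation.Binary.Reasoning.Setoid as ≈-Reasoning
open import Relation.Binary.PropositionalEquality as ≡ using (_≡_; cong; cong₂)
open import Relation.Binary.Structures using (IsEquivalence)
open import Relation.Nullary.Negation.Core using (¬_; contradiction)
open import Relation.Unary using (Pred; _⊆_)

-- Semi-Heyting algebras

module SemiHeyting {c ℓ} {A : Algebra c ℓ} (S : IsSemiHeyting A) where
  open Algebra A hiding (_≤_)
  open IsSemiHeyting S

  lattice : Lattice c ℓ
  lattice = record { isLattice = isLattice }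

  open Lattice lattice public
    using (setoid; refl; sym; trans; ∧-comm; ∧-assoc; ∧-congˡ; ∧-congʳ; ∨-congʳ)
  open LatticeProperties lattice using (∨-∧-isOrderTheoreticLattice; poset)
  -- x ≤ y stands for x ≈ x ∧ y.
  open Poset poset public using (_≤_)
  open ≈-Reasoning setoid

  agree⇒≤⇒ : ∀ {c x y} → c ∧ x ≈ c ∧ y → c ≤ x ⇒ y
  agree⇒≤⇒ {c} {x} {y} cx≈cy = sym (begin
    c ∧ (x ⇒ y)              ≈⟨ x∧[y⇒z] c x y ⟩
    c ∧ ((c ∧ x) ⇒ (c ∧ y))  ≈⟨ ∧-congˡ (⇒-cong cx≈cy refl) ⟩
    c ∧ ((c ∧ y) ⇒ (c ∧ y))  ≈⟨ ∧-congˡ (x⇒x (c ∧ y)) ⟩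
    c ∧ 𝟙                    ≈⟨ proj₂ ∧-identity c ⟩
    c                        ∎)

  ≤⇒-elim : ∀ {c x y} → c ≤ x ⇒ y → c ∧ x ≈ c ∧ (x ∧ y)
  ≤⇒-elim {c} {x} {y} c≤x⇒y = begin
    c ∧ x              ≈⟨ ∧-congʳ c≤x⇒y ⟩
    (c ∧ (x ⇒ y)) ∧ x  ≈⟨ ∧-assoc c (x ⇒ y) x ⟩
    c ∧ ((x ⇒ y) ∧ x)  ≈⟨ ∧-congˡ (∧-comm (x ⇒ y) x) ⟩
    c ∧ (x ∧ (x ⇒ y))  ≈⟨ ∧-congˡ (x∧[x⇒y] x y) ⟩
    c ∧ (x ∧ y)        ∎

  -- The operation x ⇒ (x ∧ y) is residual to the meet, so the lattice reduct
  -- is a Heyting algebra; in particular it is distributive.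
  heytingAlgebra : HeytingAlgebra c ℓ ℓ
  heytingAlgebra = record
    { _≤_ = _≤_
    ; _⇨_ = λ x y → x ⇒ (x ∧ y)
    ; ⊤   = 𝟙
    ; ⊥   = 𝟘
    ; isHeytingAlgebra = record
      { isBoundedLattice = record
        { isLattice = ∨-∧-isOrderTheoreticLattice
        ; maximum   = λ x → sym (proj₂ ∧-identity x)
        ; minimum   = λ x → begin
            𝟘            ≈⟨ ∧-absorbs-∨ 𝟘 x ⟨
            𝟘 ∧ (𝟘 ∨ x)  ≈⟨ ∧-congˡ (proj₁ ∨-identity x) ⟩
            𝟘 ∧ x        ∎
        }
      ; exponential = λ w x y →
          (λ wx≤y → agree⇒≤⇒ (trans wx≤y (∧-assoc w x y))) ,
          (λ w≤x⇨y → begin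
            w ∧ x              ≈⟨ ≤⇒-elim w≤x⇨y ⟩
            w ∧ (x ∧ (x ∧ y))  ≈⟨ ∧-congˡ (∧-assoc x x y) ⟨
            w ∧ ((x ∧ x) ∧ y)  ≈⟨ ∧-congˡ (∧-congʳ (∧-idem x)) ⟩
            w ∧ (x ∧ y)        ≈⟨ ∧-assoc w x y ⟨
            (w ∧ x) ∧ y        ∎)
      }
    }
    where
    open Lattice lattice using (∧-absorbs-∨)
    open LatticeProperties lattice using (∧-idem)

  open HeytingAlgebra heytingAlgebra public
    using ( antisym; reflexive; maximum; minimum
          ; x∧y≤x; x∧y≤y; ∧-greatest; x≤x∨y; y≤x∨y; ∨-least )
    renaming (refl to ≤-refl; trans to ≤-trans)
  open HeytingAlgebra heytingAlgebra using (meetSemilattice; joinSemilattice)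
  open MeetProperties meetSemilattice public using (∧-monotonic)
  open JoinProperties joinSemilattice public using (∨-monotonic)
  open HeytingProperties heytingAlgebra public using (∧-distribˡ-∨; distributiveLattice)
  open DistributiveProperties distributiveLattice public using (∨-distribˡ-∧)

  ∧-zeroˡ : ∀ x → 𝟘 ∧ x ≈ 𝟘
  ∧-zeroˡ x = sym (minimum x)

  ∧-distribˡ-∧ : ∀ x y z → x ∧ (y ∧ z) ≈ (x ∧ y) ∧ (x ∧ z)
  ∧-distribˡ-∧ x y z = antisym
    (∧-greatest (∧-monotonic ≤-refl (x∧y≤x y z)) (∧-monotonic ≤-refl (x∧y≤y y z)))
    (∧-greatest (≤-trans (x∧y≤x _ _) (x∧y≤x x y)) (∧-monotonic (x∧y≤y x y) (x∧y≤y x z)))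

  -- x ⇔ y is the largest element on which x and y agree.
  infix 5 _⇔_
  _⇔_ : Carrier → Carrier → Carrier
  x ⇔ y = (x ⇒ y) ∧ (y ⇒ x)

  agree⇒≤⇔ : ∀ {c x y} → c ∧ x ≈ c ∧ y → c ≤ x ⇔ y
  agree⇒≤⇔ cx≈cy = ∧-greatest (agree⇒≤⇒ cx≈cy) (agree⇒≤⇒ (sym cx≈cy))

  ≤⇔⇒agree : ∀ {c x y} → c ≤ x ⇔ y → c ∧ x ≈ c ∧ y
  ≤⇔⇒agree {c} {x} {y} c≤x⇔y = begin
    c ∧ x        ≈⟨ ≤⇒-elim (≤-trans c≤x⇔y (x∧y≤x _ _)) ⟩
    c ∧ (x ∧ y)  ≈⟨ ∧-congˡ (∧-comm x y) ⟩
    c ∧ (y ∧ x)  ≈⟨ ≤⇒-elim (≤-trans c≤x⇔y (x∧y≤y _ _)) ⟨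
    c ∧ y        ∎

  𝟙≤⇔⇒≈ : ∀ {x y} → 𝟙 ≤ x ⇔ y → x ≈ y
  𝟙≤⇔⇒≈ {x} {y} 𝟙≤x⇔y = begin
    x      ≈⟨ proj₁ ∧-identity x ⟨
    𝟙 ∧ x  ≈⟨ ≤⇔⇒agree 𝟙≤x⇔y ⟩
    𝟙 ∧ y  ≈⟨ proj₁ ∧-identity y ⟩
    y      ∎

  agree-∨ : ∀ {c x x₁ y y₁} → c ∧ x ≈ c ∧ x₁ → c ∧ y ≈ c ∧ y₁ →
            c ∧ (x ∨ y) ≈ c ∧ (x₁ ∨ y₁)
  agree-∨ {c} {x} {x₁} {y} {y₁} p q = begin
    c ∧ (x ∨ y)            ≈⟨ ∧-distribˡ-∨ c x y ⟩
    (c ∧ x) ∨ (c ∧ y)      ≈⟨ ∨-cong p q ⟩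
    (c ∧ x₁) ∨ (c ∧ y₁)    ≈⟨ ∧-distribˡ-∨ c x₁ y₁ ⟨
    c ∧ (x₁ ∨ y₁)          ∎

  agree-∧ : ∀ {c x x₁ y y₁} → c ∧ x ≈ c ∧ x₁ → c ∧ y ≈ c ∧ y₁ →
            c ∧ (x ∧ y) ≈ c ∧ (x₁ ∧ y₁)
  agree-∧ {c} {x} {x₁} {y} {y₁} p q = begin
    c ∧ (x ∧ y)            ≈⟨ ∧-distribˡ-∧ c x y ⟩
    (c ∧ x) ∧ (c ∧ y)      ≈⟨ ∧-cong p q ⟩
    (c ∧ x₁) ∧ (c ∧ y₁)    ≈⟨ ∧-distribˡ-∧ c x₁ y₁ ⟨
    c ∧ (x₁ ∧ y₁)          ∎

  agree-⇒ : ∀ {c x x₁ y y₁} → c ∧ x ≈ c ∧ x₁ → c ∧ y ≈ c ∧ y₁ →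
            c ∧ (x ⇒ y) ≈ c ∧ (x₁ ⇒ y₁)
  agree-⇒ {c} {x} {x₁} {y} {y₁} p q = begin
    c ∧ (x ⇒ y)                ≈⟨ x∧[y⇒z] c x y ⟩
    c ∧ ((c ∧ x) ⇒ (c ∧ y))    ≈⟨ ∧-congˡ (⇒-cong p q) ⟩
    c ∧ ((c ∧ x₁) ⇒ (c ∧ y₁))  ≈⟨ x∧[y⇒z] c x₁ y₁ ⟨
    c ∧ (x₁ ⇒ y₁)              ∎

  complement⇒* : ∀ {x y} → x ∧ y ≈ 𝟘 → x ∨ y ≈ 𝟙 → x * ≈ y
  complement⇒* {x} {y} xy≈𝟘 x∨y≈𝟙 = antisym
    (≤-trans (reflexive (begin
      x *                      ≈⟨ proj₂ ∧-identity (x *) ⟨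
      x * ∧ 𝟙                  ≈⟨ ∧-congˡ x∨y≈𝟙 ⟨
      x * ∧ (x ∨ y)            ≈⟨ ∧-distribˡ-∨ (x *) x y ⟩
      (x * ∧ x) ∨ (x * ∧ y)    ≈⟨ ∨-congʳ (trans (∧-comm (x *) x) (x∧[x⇒y] x 𝟘)) ⟩
      (x ∧ 𝟘) ∨ (x * ∧ y)      ∎))
      (∨-least (≤-trans (x∧y≤y x 𝟘) (minimum y)) (x∧y≤y (x *) y)))
    (agree⇒≤⇒ (begin
      y ∧ x  ≈⟨ ∧-comm y x ⟩
      x ∧ y  ≈⟨ xy≈𝟘 ⟩
      𝟘      ≈⟨ ∧-zeroˡ y ⟨
      𝟘 ∧ y  ≈⟨ ∧-comm 𝟘 y ⟩
      y ∧ 𝟘  ∎))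

-- Dually Stone semi-Heyting algebras

module DuallyStone {c ℓ} {A : Algebra c ℓ} (D : IsDSt A) where
  open Algebra A hiding (_≤_)
  open IsDSt D public
  open IsDQD isDQD public
  open IsSemiHeyting isSemiHeyting public using (∧-identity; ∨-identity)
  open SemiHeyting isSemiHeyting public
  open ≈-Reasoning setoid

  ′′-decreasing : ∀ x → x ′ ′ ≤ x
  ′′-decreasing x = sym (x′′≤x x)

  ′-antitone : ∀ {x y} → x ≤ y → y ′ ≤ x ′
  ′-antitone {x} {y} x≤y = ≤-trans (y≤x∨y (x ′) (y ′)) (reflexive (begin
    x ′ ∨ y ′  ≈⟨ [x∧y]′ x y ⟨
    (x ∧ y) ′  ≈⟨ ′-cong x≤y ⟨
    x ′        ∎))

  ′′′≈′ : ∀ x → x ′ ′ ′ ≈ x ′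
  ′′′≈′ x = antisym (′′-decreasing (x ′)) (′-antitone (′′-decreasing x))

  x′∨x′′ : ∀ x → x ′ ∨ x ′ ′ ≈ 𝟙
  x′∨x′′ x = begin
    x ′ ∨ x ′ ′        ≈⟨ ∨-congʳ (′′′≈′ x) ⟨
    x ′ ′ ′ ∨ x ′ ′    ≈⟨ [x∧y]′ (x ′ ′) (x ′) ⟨
    (x ′ ′ ∧ x ′) ′    ≈⟨ ′-cong (∧-comm (x ′ ′) (x ′)) ⟩
    (x ′ ∧ x ′ ′) ′    ≈⟨ ′-cong (x′∧x′′ x) ⟩
    𝟘 ′                ≈⟨ 𝟘′ ⟩
    𝟙                  ∎

  𝟙≤x′∨x : ∀ x → 𝟙 ≤ x ′ ∨ x
  𝟙≤x′∨x x = ≤-trans (reflexive (sym (x′∨x′′ x))) (∨-monotonic ≤-refl (′′-decreasing x))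

  x′*≈x′′ : ∀ x → (x ′) * ≈ x ′ ′
  x′*≈x′′ x = complement⇒* (x′∧x′′ x) (x′∨x′′ x)

  level-one : IsDQDₙ A 1
  level-one = record
    { isDQD = isDQD
    ; level = λ x → begin
        x ∧ (x ′) *                      ≈⟨ ∧-congˡ (∧-idem ((x ′) *)) ⟨
        x ∧ ((x ′) * ∧ (x ′) *)          ≈⟨ ∧-assoc x _ _ ⟨
        (x ∧ (x ′) *) ∧ (x ′) *          ≈⟨ ∧-congˡ (level-two x) ⟨
        (x ∧ (x ′) *) ∧ (((x ′) *) ′) *  ∎
    }
    where
    open LatticeProperties lattice using (∧-idem)
    level-two : ∀ x → (((x ′) *) ′) * ≈ (x ′) *
    level-two x = begin
      (((x ′) *) ′) *  ≈⟨ ⇒-cong (′-cong (x′*≈x′′ x)) refl ⟩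
      (x ′ ′ ′) *      ≈⟨ ⇒-cong (′′′≈′ x) refl ⟩
      (x ′) *          ∎

  -- k is central, being of the form g′′, so agreement on k is respected by ′.
  agree-′ : ∀ {g x y} → let k = g ′ ′ in k ∧ x ≈ k ∧ y → k ∧ x ′ ≈ k ∧ y ′
  agree-′ {g} {x} {y} p = begin
    k ∧ x ′        ≈⟨ absorb x ⟨
    k ∧ (k ∧ x) ′  ≈⟨ ∧-congˡ (′-cong p) ⟩
    k ∧ (k ∧ y) ′  ≈⟨ absorb y ⟩
    k ∧ y ′        ∎
    where
    k = g ′ ′
    absorb : ∀ z → k ∧ (k ∧ z) ′ ≈ k ∧ z ′
    absorb z = begin
      k ∧ (k ∧ z) ′            ≈⟨ ∧-congˡ ([x∧y]′ k z) ⟩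
      k ∧ (k ′ ∨ z ′)          ≈⟨ ∧-distribˡ-∨ k (k ′) (z ′) ⟩
      (k ∧ k ′) ∨ (k ∧ z ′)    ≈⟨ ∨-congʳ (x′∧x′′ (g ′)) ⟩
      𝟘 ∨ (k ∧ z ′)            ≈⟨ proj₁ ∨-identity _ ⟩
      k ∧ z ′                  ∎

  -- The value of the discriminator term defined below.
  discriminate : Carrier → Carrier → Carrier → Carrier
  discriminate x y z = ((x ⇔ y) ′ ∧ x) ∨ ((x ⇔ y) ′ ′ ∧ z)

  discriminate-equal : ∀ x z → discriminate x x z ≈ z
  discriminate-equal x z = begin
    ((x ⇔ x) ′ ∧ x) ∨ ((x ⇔ x) ′ ′ ∧ z)  ≈⟨ ∨-cong (∧-congʳ [x⇔x]′≈𝟘)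
                                                     (∧-congʳ (trans (′-cong [x⇔x]′≈𝟘) 𝟘′)) ⟩
    (𝟘 ∧ x) ∨ (𝟙 ∧ z)                    ≈⟨ ∨-cong (∧-zeroˡ x) (proj₁ ∧-identity z) ⟩
    𝟘 ∨ z                                ≈⟨ proj₁ ∨-identity z ⟩
    z                                    ∎
    where
    [x⇔x]′≈𝟘 : (x ⇔ x) ′ ≈ 𝟘
    [x⇔x]′≈𝟘 = begin
      (x ⇔ x) ′  ≈⟨ ′-cong (antisym (maximum _) (agree⇒≤⇔ refl)) ⟩
      𝟙 ′        ≈⟨ 𝟙′ ⟩
      𝟘          ∎

  discriminate-distinct : ∀ {x y} z → (x ⇔ y) ′ ≈ 𝟙 → discriminate x y z ≈ x
  discriminate-distinct {x} {y} z d′≈𝟙 = begin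
    ((x ⇔ y) ′ ∧ x) ∨ ((x ⇔ y) ′ ′ ∧ z)  ≈⟨ ∨-cong (∧-congʳ d′≈𝟙)
                                                     (∧-congʳ (trans (′-cong d′≈𝟙) 𝟙′)) ⟩
    (𝟙 ∧ x) ∨ (𝟘 ∧ z)                    ≈⟨ ∨-cong (proj₁ ∧-identity x) (∧-zeroˡ z) ⟩
    x ∨ 𝟘                                ≈⟨ proj₂ ∨-identity x ⟩
    x                                    ∎

-- The term ((x ⇔ y)′ ∧ x) ∨ ((x ⇔ y)′′ ∧ z).
discriminator : Term (Fin 3)
discriminator = ((d ′ₜ) ∧ₜ x) ∨ₜ (((d ′ₜ) ′ₜ) ∧ₜ z)
  where
  x = var zero
  y = var (suc zero)
  z = var (suc (suc zero))
  d = (x ⇒ₜ y) ∧ₜ (y ⇒ₜ x)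

-- DSt as an equational class

module Identities where
  private
    x y z : Term ℕ
    x = var 0
    y = var 1
    z = var 2

  -- Defining identities of DSt.
  data Axiom : Pred Equation 0ℓ where
    ∨-comm      : Axiom (x ∨ₜ y , y ∨ₜ x)
    ∨-assoc     : Axiom ((x ∨ₜ y) ∨ₜ z , x ∨ₜ (y ∨ₜ z))
    ∧-comm      : Axiom (x ∧ₜ y , y ∧ₜ x)
    ∧-assoc     : Axiom ((x ∧ₜ y) ∧ₜ z , x ∧ₜ (y ∧ₜ z))
    ∨-absorbs-∧ : Axiom (x ∨ₜ (x ∧ₜ y) , x)
    ∧-absorbs-∨ : Axiom (x ∧ₜ (x ∨ₜ y) , x)
    ∨-identityˡ : Axiom (𝟘ₜ ∨ₜ x , x)
    ∨-identityʳ : Axiom (x ∨ₜ 𝟘ₜ , x)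
    ∧-identityˡ : Axiom (𝟙ₜ ∧ₜ x , x)
    ∧-identityʳ : Axiom (x ∧ₜ 𝟙ₜ , x)
    x∧[x⇒y]     : Axiom (x ∧ₜ (x ⇒ₜ y) , x ∧ₜ y)
    x∧[y⇒z]     : Axiom (x ∧ₜ (y ⇒ₜ z) , x ∧ₜ ((x ∧ₜ y) ⇒ₜ (x ∧ₜ z)))
    x⇒x         : Axiom (x ⇒ₜ x , 𝟙ₜ)
    𝟘′          : Axiom (𝟘ₜ ′ₜ , 𝟙ₜ)
    𝟙′          : Axiom (𝟙ₜ ′ₜ , 𝟘ₜ)
    [x∧y]′      : Axiom ((x ∧ₜ y) ′ₜ , (x ′ₜ) ∨ₜ (y ′ₜ))
    [x∨y]′′     : Axiom (((x ∨ₜ y) ′ₜ) ′ₜ , ((x ′ₜ) ′ₜ) ∨ₜ ((y ′ₜ) ′ₜ))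
    x′′≤x       : Axiom (((x ′ₜ) ′ₜ) ∧ₜ x , (x ′ₜ) ′ₜ)
    x′∧x′′      : Axiom ((x ′ₜ) ∧ₜ ((x ′ₜ) ′ₜ) , 𝟘ₜ)

open Identities using (Axiom)

DSt⊆Mod : ∀ {c ℓ} → DSt c ℓ ⊆ Mod Axiom
DSt⊆Mod {x = A} D e ax ρ = holds ax
  where
  open Algebra A using (_≈_)
  open IsDSt D
  open IsDQD isDQD
  open IsSemiHeyting isSemiHeyting
  open LatticeStructures.IsLattice isLattice
  holds : ∀ {e} → Axiom e → ⟦_⟧ A (proj₁ e) ρ ≈ ⟦_⟧ A (proj₂ e) ρ
  holds Identities.∨-comm      = ∨-comm _ _
  holds Identities.∨-assoc     = ∨-assoc _ _ _
  holds Identities.∧-comm      = ∧-comm _ _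
  holds Identities.∧-assoc     = ∧-assoc _ _ _
  holds Identities.∨-absorbs-∧ = ∨-absorbs-∧ _ _
  holds Identities.∧-absorbs-∨ = ∧-absorbs-∨ _ _
  holds Identities.∨-identityˡ = proj₁ ∨-identity _
  holds Identities.∨-identityʳ = proj₂ ∨-identity _
  holds Identities.∧-identityˡ = proj₁ ∧-identity _
  holds Identities.∧-identityʳ = proj₂ ∧-identity _
  holds Identities.x∧[x⇒y]     = x∧[x⇒y] _ _
  holds Identities.x∧[y⇒z]     = x∧[y⇒z] _ _ _
  holds Identities.x⇒x         = x⇒x _
  holds Identities.𝟘′          = 𝟘′
  holds Identities.𝟙′          = 𝟙′
  holds Identities.[x∧y]′      = [x∧y]′ _ _
  holds Identities.[x∨y]′′     = [x∨y]′′ _ _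
  holds Identities.x′′≤x       = x′′≤x _
  holds Identities.x′∧x′′      = x′∧x′′ _

Mod⊆DSt : ∀ {c ℓ} → Mod Axiom ⊆ DSt c ℓ
Mod⊆DSt {x = A} ⊨Axiom = record
  { isDQD = record
    { isSemiHeyting = record
      { isLattice = record
        { isEquivalence = isEquivalence
        ; ∨-comm        = λ x y → ⊨Axiom _ Identities.∨-comm (val x y y)
        ; ∨-assoc       = λ x y z → ⊨Axiom _ Identities.∨-assoc (val x y z)
        ; ∨-cong        = ∨-cong
        ; ∧-comm        = λ x y → ⊨Axiom _ Identities.∧-comm (val x y y)
        ; ∧-assoc       = λ x y z → ⊨Axiom _ Identities.∧-assoc (val x y z)
        ; ∧-cong        = ∧-cong
        ; absorptive    = (λ x y → ⊨Axiom _ Identities.∨-absorbs-∧ (val x y y))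
                        , (λ x y → ⊨Axiom _ Identities.∧-absorbs-∨ (val x y y))
        }
      ; ∨-identity = (λ x → ⊨Axiom _ Identities.∨-identityˡ (val x x x))
                   , (λ x → ⊨Axiom _ Identities.∨-identityʳ (val x x x))
      ; ∧-identity = (λ x → ⊨Axiom _ Identities.∧-identityˡ (val x x x))
                   , (λ x → ⊨Axiom _ Identities.∧-identityʳ (val x x x))
      ; x∧[x⇒y]    = λ x y → ⊨Axiom _ Identities.x∧[x⇒y] (val x y y)
      ; x∧[y⇒z]    = λ x y z → ⊨Axiom _ Identities.x∧[y⇒z] (val x y z)
      ; x⇒x        = λ x → ⊨Axiom _ Identities.x⇒x (val x x x)
      }
    ; 𝟘′      = ⊨Axiom _ Identities.𝟘′ (λ _ → 𝟘)
    ; 𝟙′      = ⊨Axiom _ Identities.𝟙′ (λ _ → 𝟘)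
    ; [x∧y]′  = λ x y → ⊨Axiom _ Identities.[x∧y]′ (val x y y)
    ; [x∨y]′′ = λ x y → ⊨Axiom _ Identities.[x∨y]′′ (val x y y)
    ; x′′≤x   = λ x → ⊨Axiom _ Identities.x′′≤x (val x x x)
    }
  ; x′∧x′′ = λ x → ⊨Axiom _ Identities.x′∧x′′ (val x x x)
  }
  where
  open Algebra A
  val : Carrier → Carrier → Carrier → ℕ → Carrier
  val x y z 0             = x
  val x y z 1             = y
  val x y z (suc (suc _)) = z

DSt-isVariety : ∀ {c ℓ} → IsVariety (DSt c ℓ)
DSt-isVariety = Axiom , DSt⊆Mod , Mod⊆DSt

-- Enumeration of terms

-- The compound terms with immediate subterms in a given list.
compounds : ∀ {X} → List (Term X) → List (Term X)
compounds ts =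
  map _′ₜ ts ++
  cartesianProductWith _∨ₜ_ ts ts ++
  cartesianProductWith _∧ₜ_ ts ts ++
  cartesianProductWith _⇒ₜ_ ts ts

-- An increasing sequence of finite lists that exhausts the terms.
newTerms terms : ℕ → List (Term ℕ)
newTerms n = 𝟘ₜ ∷ 𝟙ₜ ∷ var n ∷ compounds (terms n)
terms zero    = []
terms (suc n) = newTerms n ++ terms n

terms-mono : ∀ {m n t} → m ≤′ n → t ∈ terms m → t ∈ terms n
terms-mono             ≤′-refl        t∈ = t∈
terms-mono {n = suc n} (≤′-step m≤n) t∈ = ∈-++⁺ʳ (newTerms n) (terms-mono m≤n t∈)

terms-⊔ : ∀ {s t} → ∃[ m ] s ∈ terms m → ∃[ n ] t ∈ terms n →
          ∃[ k ] s ∈ terms k × t ∈ terms k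
terms-⊔ (m , s∈) (n , t∈) =
  m ℕ.⊔ n , terms-mono (≤⇒≤′ (m≤m⊔n m n)) s∈ , terms-mono (≤⇒≤′ (m≤n⊔m m n)) t∈

compound∈terms : ∀ {t} n → t ∈ compounds (terms n) → ∃[ m ] t ∈ terms m
compound∈terms n t∈ = suc n , there (there (there (∈-++⁺ˡ t∈)))

terms-exhaustive : ∀ t → ∃[ n ] t ∈ terms n
terms-exhaustive (var n) = suc n , there (there (here ≡.refl))
terms-exhaustive 𝟘ₜ      = 1 , here ≡.refl
terms-exhaustive 𝟙ₜ      = 1 , there (here ≡.refl)
terms-exhaustive (t ′ₜ) with n , t∈ ← terms-exhaustive t =
  compound∈terms n (∈-++⁺ˡ (∈-map⁺ _′ₜ t∈))
terms-exhaustive (s ∨ₜ t)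
  with n , s∈ , t∈ ← terms-⊔ (terms-exhaustive s) (terms-exhaustive t) =
  compound∈terms n (∈-++⁺ʳ (map _′ₜ (terms n))
    (∈-++⁺ˡ (∈-cartesianProductWith⁺ _∨ₜ_ s∈ t∈)))
terms-exhaustive (s ∧ₜ t)
  with n , s∈ , t∈ ← terms-⊔ (terms-exhaustive s) (terms-exhaustive t) =
  compound∈terms n (∈-++⁺ʳ (map _′ₜ (terms n))
    (∈-++⁺ʳ (cartesianProductWith _∨ₜ_ (terms n) (terms n))
    (∈-++⁺ˡ (∈-cartesianProductWith⁺ _∧ₜ_ s∈ t∈))))
terms-exhaustive (s ⇒ₜ t)
  with n , s∈ , t∈ ← terms-⊔ (terms-exhaustive s) (terms-exhaustive t) =
  compound∈terms n (∈-++⁺ʳ (map _′ₜ (terms n))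
    (∈-++⁺ʳ (cartesianProductWith _∨ₜ_ (terms n) (terms n))
    (∈-++⁺ʳ (cartesianProductWith _∧ₜ_ (terms n) (terms n))
    (∈-cartesianProductWith⁺ _⇒ₜ_ s∈ t∈))))

-- Normal filters and quotients of the term algebra

module NormalFilters {c ℓ} {A : Algebra c ℓ} (D : IsDSt A) where
  open Algebra A hiding (_≤_)
  open DuallyStone D

  -- Normal filters: the filters closed under x ↦ x′′.  They need not be proper.
  record IsNormalFilter {p} (F : Pred Carrier p) : Set (c ⊔ ℓ ⊔ p) where
    field
      𝟙∈        : F 𝟙
      ↑-closed  : ∀ {x y} → x ≤ y → F x → F y
      ∧-closed  : ∀ {x y} → F x → F y → F (x ∧ y)
      ′′-closed : ∀ {x} → F x → F (x ′ ′)

  -- The algebra of terms in countably many variables, each term standing for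
  -- its value under ρ, modulo the congruence of a normal filter.  The carrier
  -- is lifted to the universe level of A.
  module TermQuotient (ρ : ℕ → Carrier) {F : Pred Carrier ℓ} (N : IsNormalFilter F) where
    open IsNormalFilter N

    agree⇒F⇔ : ∀ {c x y} → F c → c ∧ x ≈ c ∧ y → F (x ⇔ y)
    agree⇒F⇔ Fc cx≈cy = ↑-closed (agree⇒≤⇔ cx≈cy) Fc

    ≈⇒F⇔ : ∀ {x y} → x ≈ y → F (x ⇔ y)
    ≈⇒F⇔ x≈y = agree⇒F⇔ 𝟙∈ (∧-congˡ x≈y)

    -- Two congruent pairs agree on a common central member of the filter.
    F⇔⇒agree : ∀ {x x₁ y y₁} → F (x ⇔ x₁) → F (y ⇔ y₁) →
               ∃[ g ] F (g ′ ′) × (g ′ ′ ∧ x ≈ g ′ ′ ∧ x₁) × (g ′ ′ ∧ y ≈ g ′ ′ ∧ y₁)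
    F⇔⇒agree {x} {x₁} {y} {y₁} p q =
      g , ′′-closed (∧-closed p q) ,
      ≤⇔⇒agree (≤-trans (′′-decreasing g) (x∧y≤x _ _)) ,
      ≤⇔⇒agree (≤-trans (′′-decreasing g) (x∧y≤y _ _))
      where g = (x ⇔ x₁) ∧ (y ⇔ y₁)

    value : Lift c (Term ℕ) → Carrier
    value (lift t) = ⟦_⟧ A t ρ

    _~_ : Rel Carrier ℓ
    x ~ y = F (x ⇔ y)

    ~-isEquivalence : IsEquivalence _~_
    ~-isEquivalence = record
      { refl  = ≈⇒F⇔ refl
      ; sym   = λ p → ↑-closed (reflexive (∧-comm _ _)) p
      ; trans = λ p q → let _ , Fc , xy , yz = F⇔⇒agree p q in agree⇒F⇔ Fc (trans xy yz)
      }

    termQuotient : Algebra c ℓ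
    termQuotient = record
      { Carrier = Lift c (Term ℕ)
      ; _≈_     = _~_ on value
      ; _∨_     = λ (lift s) (lift t) → lift (s ∨ₜ t)
      ; _∧_     = λ (lift s) (lift t) → lift (s ∧ₜ t)
      ; _⇒_     = λ (lift s) (lift t) → lift (s ⇒ₜ t)
      ; _′      = λ (lift t) → lift (t ′ₜ)
      ; 𝟘       = lift 𝟘ₜ
      ; 𝟙       = lift 𝟙ₜ
      ; isEquivalence = record
        { refl  = ~.refl
        ; sym   = ~.sym
        ; trans = ~.trans
        }
      ; ∨-cong = λ p q → let _ , Fc , a , b = F⇔⇒agree p q in agree⇒F⇔ Fc (agree-∨ a b)
      ; ∧-cong = λ p q → let _ , Fc , a , b = F⇔⇒agree p q in agree⇒F⇔ Fc (agree-∧ a b)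
      ; ⇒-cong = λ p q → let _ , Fc , a , b = F⇔⇒agree p q in agree⇒F⇔ Fc (agree-⇒ a b)
      ; ′-cong = λ p → let _ , Fc , a , _ = F⇔⇒agree p p in agree⇒F⇔ Fc (agree-′ a)
      }
      where module ~ = IsEquivalence ~-isEquivalence

    value-hom : ∀ t (σ : ℕ → Lift c (Term ℕ)) →
                value (⟦_⟧ termQuotient t σ) ≡ ⟦_⟧ A t (value ∘ σ)
    value-hom (var x)  σ = ≡.refl
    value-hom (s ∨ₜ t) σ = cong₂ _∨_ (value-hom s σ) (value-hom t σ)
    value-hom (s ∧ₜ t) σ = cong₂ _∧_ (value-hom s σ) (value-hom t σ)
    value-hom (s ⇒ₜ t) σ = cong₂ _⇒_ (value-hom s σ) (value-hom t σ)
    value-hom (t ′ₜ)   σ = cong _′ (value-hom t σ)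
    value-hom 𝟘ₜ       σ = ≡.refl
    value-hom 𝟙ₜ       σ = ≡.refl

    termQuotient-preserves : ∀ e → A ⊨ e → termQuotient ⊨ e
    termQuotient-preserves (s , t) A⊨e σ =
      ≡.subst₂ _~_ (≡.sym (value-hom s σ)) (≡.sym (value-hom t σ)) (≈⇒F⇔ (A⊨e (value ∘ σ)))

    termQuotient-reflects : ∀ s t → termQuotient ⊨ (s , t) → ⟦_⟧ A s ρ ~ ⟦_⟧ A t ρ
    termQuotient-reflects s t ⊨st =
      ≡.subst₂ _~_ (value-hom s (lift ∘ var)) (value-hom t (lift ∘ var)) (⊨st (lift ∘ var))

    termQuotient-DSt : IsDSt termQuotient
    termQuotient-DSt =
      Mod⊆DSt (λ e ax → termQuotient-preserves e (DSt⊆Mod D e ax))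

    -- If s and t are not congruent, then s ⇔ t has value outside F, and so
    -- (s ⇔ t)′ has value in F, which makes it congruent to 𝟙.
    termQuotient-discriminator :
      (∀ t → ¬ F (⟦_⟧ A t ρ) → F (⟦_⟧ A t ρ ′)) →
      RepresentsDiscriminator termQuotient discriminator
    termQuotient-discriminator decides =
      Q.discriminate-equal ,
      λ { (lift s) (lift t) z s≉t → Q.discriminate-distinct {lift s} {lift t} z
            (let Fd′ = decides ((s ⇒ₜ t) ∧ₜ (t ⇒ₜ s)) s≉t
             in agree⇒F⇔ Fd′ (antisym (∧-monotonic ≤-refl (maximum _))
                                      (∧-greatest (x∧y≤x _ _) (x∧y≤x _ _)))) }
      where module Q = DuallyStone termQuotient-DSt

  -- The normal filter generated by F and b, provided that b′ is not in F;
  -- otherwise F itself.  In a distributive lattice where b′ is the complement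
  -- of b′′, x lies above a meet f ∧ b′′ with f ∈ F iff b′ ∨ x ∈ F.  The
  -- condition is part of the membership predicate, so it need not be decidable.
  adjoin : ∀ {p} → Carrier → Pred Carrier p → Pred Carrier p
  adjoin b F x = F x ⊎ (¬ F (b ′) × F (b ′ ∨ x))

  module _ {p} {F : Pred Carrier p} (N : IsNormalFilter F) where
    open IsNormalFilter N

    adjoin-isNormalFilter : ∀ b → IsNormalFilter (adjoin b F)
    adjoin-isNormalFilter b = record
      { 𝟙∈        = inj₁ 𝟙∈
      ; ↑-closed  = λ where
          x≤y (inj₁ Fx)       → inj₁ (↑-closed x≤y Fx)
          x≤y (inj₂ (b′∉ , p)) → inj₂ (b′∉ , ↑-closed (∨-monotonic ≤-refl x≤y) p)
      ; ∧-closed  = λ where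
          (inj₁ Fx)        (inj₁ Fy)        → inj₁ (∧-closed Fx Fy)
          (inj₁ Fx)        (inj₂ (b′∉ , q)) → inj₂ (b′∉ , meet (weaken Fx) q)
          (inj₂ (b′∉ , p)) (inj₁ Fy)        → inj₂ (b′∉ , meet p (weaken Fy))
          (inj₂ (b′∉ , p)) (inj₂ (_ , q))   → inj₂ (b′∉ , meet p q)
      ; ′′-closed = λ where
          (inj₁ Fx)        → inj₁ (′′-closed Fx)
          (inj₂ (b′∉ , p)) → inj₂ (b′∉ , ↑-closed (≤-trans (reflexive ([x∨y]′′ _ _))
                               (∨-monotonic (′′-decreasing (b ′)) ≤-refl)) (′′-closed p))
      }
      where
      weaken : ∀ {x} → F x → F (b ′ ∨ x)
      weaken = ↑-closed (y≤x∨y _ _)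
      meet : ∀ {x y} → F (b ′ ∨ x) → F (b ′ ∨ y) → F (b ′ ∨ x ∧ y)
      meet p q = ↑-closed (reflexive (sym (∨-distribˡ-∧ _ _ _))) (∧-closed p q)

    adjoin-self : ∀ {b} → ¬ F (b ′) → adjoin b F b
    adjoin-self {b} b′∉ = inj₂ (b′∉ , ↑-closed (𝟙≤x′∨x b) 𝟙∈)

    adjoin-proper : ∀ {b} → adjoin b F 𝟘 → F 𝟘
    adjoin-proper (inj₁ F𝟘)         = F𝟘
    adjoin-proper (inj₂ (b′∉ , p)) =
      contradiction (↑-closed (∨-least ≤-refl (minimum _)) p) b′∉

  ↑′-isNormalFilter : ∀ a → IsNormalFilter (a ′ ≤_)
  ↑′-isNormalFilter a = record
    { 𝟙∈        = maximum _
    ; ↑-closed  = λ x≤y a′≤x → ≤-trans a′≤x x≤y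
    ; ∧-closed  = ∧-greatest
    ; ′′-closed = λ a′≤x →
        ≤-trans (reflexive (sym (′′′≈′ a))) (′-antitone (′-antitone a′≤x))
    }

  -- A constructive form of the extension of a normal filter to a maximal one,
  -- relative to the subalgebra generated by the values of ρ.  The given filter
  -- may be improper; the completion then is improper as well.
  module Completion (ρ : ℕ → Carrier) {p} {F : Pred Carrier p} (N : IsNormalFilter F) where

    -- Treats the terms of the list from its end to its front.
    extend : List (Term ℕ) → Pred Carrier p
    extend []       = F
    extend (t ∷ ts) = adjoin (⟦_⟧ A t ρ) (extend ts)

    extend-isNormalFilter : ∀ ts → IsNormalFilter (extend ts)
    extend-isNormalFilter []       = N
    extend-isNormalFilter (t ∷ ts) = adjoin-isNormalFilter (extend-isNormalFilter ts) _

    extend-++ : ∀ ss {ts} → extend ts ⊆ extend (ss ++ ts)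
    extend-++ []       x∈ = x∈
    extend-++ (s ∷ ss) x∈ = inj₁ (extend-++ ss x∈)

    extend-proper : ∀ ts → extend ts 𝟘 → F 𝟘
    extend-proper []       𝟘∈ = 𝟘∈
    extend-proper (t ∷ ts) 𝟘∈ =
      extend-proper ts (adjoin-proper (extend-isNormalFilter ts) 𝟘∈)

    extend-decides : ∀ {t ts} → t ∈ ts → ¬ extend ts (⟦_⟧ A t ρ ′) → extend ts (⟦_⟧ A t ρ)
    extend-decides {ts = _ ∷ ts} (here ≡.refl) t′∉ =
      adjoin-self (extend-isNormalFilter ts) (t′∉ ∘ inj₁)
    extend-decides               (there t∈)    t′∉ = inj₁ (extend-decides t∈ (t′∉ ∘ inj₁))

    -- The union of the extensions along the enumeration of terms.
    completion : Pred Carrier p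
    completion x = ∃[ n ] extend (terms n) x

    extend-mono : ∀ {m n} → m ≤′ n → extend (terms m) ⊆ extend (terms n)
    extend-mono ≤′-refl x∈ = x∈
    extend-mono {n = suc n} (≤′-step m≤n) x∈ = extend-++ (newTerms n) (extend-mono m≤n x∈)

    completion-isNormalFilter : IsNormalFilter completion
    completion-isNormalFilter = record
      { 𝟙∈        = 0 , IsNormalFilter.𝟙∈ N
      ; ↑-closed  = λ x≤y (n , x∈) → n , Fₙ.↑-closed n x≤y x∈
      ; ∧-closed  = λ (m , x∈) (n , y∈) → m ℕ.⊔ n ,
          Fₙ.∧-closed (m ℕ.⊔ n) (extend-mono (≤⇒≤′ (m≤m⊔n m n)) x∈)
                                (extend-mono (≤⇒≤′ (m≤n⊔m m n)) y∈)
      ; ′′-closed = λ (n , x∈) → n , Fₙ.′′-closed n x∈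
      }
      where module Fₙ n = IsNormalFilter (extend-isNormalFilter (terms n))

    base⊆completion : F ⊆ completion
    base⊆completion x∈ = 0 , x∈

    proper : completion 𝟘 → F 𝟘
    proper (n , 𝟘∈) = extend-proper (terms n) 𝟘∈

    -- The term t′ is adjoined at some stage unless t′′ is already present,
    -- but t′′ ≤ t and t is not in the completion.
    decides : ∀ t → ¬ completion (⟦_⟧ A t ρ) → completion (⟦_⟧ A t ρ ′)
    decides t t∉ with n , t′∈ ← terms-exhaustive (t ′ₜ) =
      n , extend-decides t′∈ (λ t′′∈ → t∉ (n , Fₙ.↑-closed n (′′-decreasing _) t′′∈))
      where module Fₙ n = IsNormalFilter (extend-isNormalFilter (terms n))

-- Generation of DSt

-- The dually Stone algebras on which the discriminator term does represent
-- the discriminator function.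
Discriminated : (c ℓ : Level) → Pred (Algebra c ℓ) (c ⊔ ℓ)
Discriminated c ℓ A = IsDSt A × RepresentsDiscriminator A discriminator

-- The complement d′ of d = s ⇔ t lies in the initial filter, d in its
-- completion; so 𝟘 is in the latter, hence in the former.
Discriminated⊨⇒DSt⊨ : ∀ {c ℓ} e → (∀ {B} → Discriminated c ℓ B → B ⊨ e) →
                       ∀ {A} → DSt c ℓ A → A ⊨ e
Discriminated⊨⇒DSt⊨ {c} {ℓ} (s , t) K⊨e {A} D ρ =
  𝟙≤⇔⇒≈ (≤-trans (𝟙≤x′∨x d) (∨-least (≤-trans d′≤𝟘 (minimum d)) ≤-refl))
  where
  open Algebra A hiding (_≤_)
  open DuallyStone D
  open NormalFilters D
  d = ⟦_⟧ A s ρ ⇔ ⟦_⟧ A t ρ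
  open Completion ρ (↑′-isNormalFilter d)
  open TermQuotient ρ completion-isNormalFilter
  open IsNormalFilter completion-isNormalFilter

  d∈ : completion d
  d∈ = termQuotient-reflects s t
         (K⊨e (termQuotient-DSt , termQuotient-discriminator decides))

  d′≤𝟘 : d ′ ≤ 𝟘
  d′≤𝟘 = proper (↑-closed (reflexive (trans (∧-comm _ _) (x′∧x′′ d)))
                   (∧-closed (′′-closed d∈) (base⊆completion ≤-refl)))

corollary4p4 : (c ℓ : Level) →
    IsDiscriminatorVariety (DSt c ℓ) × (DSt c ℓ ⊆ DQD[ 1 ] c ℓ)
corollary4p4 c ℓ =
  ( Discriminated c ℓ
  , ( DSt-isVariety
    , proj₁
    , λ W (Σ , W⊆Mod , Mod⊆W) K⊆W D → Mod⊆W λ e e∈Σ →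
        Discriminated⊨⇒DSt⊨ e (λ B∈K → W⊆Mod (K⊆W B∈K) e e∈Σ) D )
  , discriminator , λ _ → proj₂ )
  , DuallyStone.level-one
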